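{- Let $U$ be a finite set, and let $\alpha(\mathcal V)$, $\beta(\mathcal V)$, and, for every $u\in U$, $\gamma_u(\mathcal V,\mathcal W)$ and $\delta_u(\mathcal V,\mathcal V',\mathcal W)$ be constraints (first-order formulas over $\Sigma$ with the indicated free variables). Consider the set of formulas (A) over the unknown predicates $Inv(\mathcal V)$ and $\{A_u(\mathcal V,\mathcal W)\}_{u\in U}$: \begin{align*} &(A1)\quad \alpha(\mathcal V)\to Inv(\mathcal V)\\ &(A2)\quad Inv(\mathcal V)\wedge\beta(\mathcal V)\to\bot\\ &(A3)\quad Inv(\mathcal V)\wedge A_u(\mathcal V,\mathcal W)\wedge\gamma_u(\mathcal V,\mathcal W)\to\bot\qquad\text{for every }u\in U\\ &(A4)\quad Inv(\mathcal V)\wedge A_u(\mathcal V,\mathcal W)\wedge\delta_u(\mathcal V,\mathcal V',\mathcal W)\to Inv(\mathcal V')\qquad\text{for every }u\in U\\ &(A5)\quad Inv(\mathcal V)\to\bigvee_{u\in U}A_u(\mathcal V,\mathcal W) \end{align*} and the system of constrained Horn clauses (D) over the unknown predicates $\{D_u(\mathcal V,\mathcal W)\}_{u\in U}$: \begin{align*} &(D1)\quad \bigwedge_{u\in U}D_u(\mathcal V,\mathcal W)\wedge\alpha(\mathcal V)\to\bot\\ &(D2)\quad \beta(\mathcal V)\to D_u(\mathcal V,\mathcal W)\qquad\text{for every }u\in U\\ &(D3)\quad \gamma_u(\mathcal V,\mathcal W)\to D_u(\mathcal V,\mathcal W)\qquad\text{for every }u\in U\\ &(D4)\quad \bigwedge_{u'\in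 U}D_{u'}(\mathcal V',\mathcal W')\wedge\delta_u(\mathcal V,\mathcal V',\mathcal W)\to D_u(\mathcal V,\mathcal W)\qquad\text{for every }u\in U \end{align*} Then (A) is satisfiable if and only if (D) is satisfiable (both modulo the background theory $\mathcal T$). Furthermore, there is an efficient translation of models of (A) to models of (D), and vice versa.
   Context: Fix a background many-sorted first-order theory $\mathcal T$ with signature $\Sigma$ (sorts are interpreted by nonempty domains). $\mathcal V,\mathcal V',\mathcal W,\mathcal W'$ are pairwise disjoint finite vectors of sorted logical variables, where $\mathcal V'$ is a primed copy of $\mathcal V$ and $\mathcal W'$ a primed copy of $\mathcal W$ ($\mathcal W$ may be empty). All variables in the displayed formulas are implicitly universally quantified. A constraint is a first-order formula over $\Sigma$ (no occurrence of unknown predicates). The unknown predicates ($Inv$, $A_u$, $D_u$) are uninterpreted predicate symbols not in $\Sigma$, with arguments of the sorts of the indicated variable vectors. A set of formulas over $\Sigma$ extended by unknown predicates is satisfiable (modulo $\mathcal T$) if there is a model of $\mathcal T$, together with an interpretation of the unknown predicates, satisfying all formulas in the set; such a structure is called a model of the set. A constrained Horn clause (CHC) is a formula $\forall \mathcal X\cdot\bigwedge_i P_i(\mathcal X_i)\wedge\varphi(\mathcal X)\to H(\mathcal X_H)$ where the $P_i$ are unknown predicates, $\varphi$ is a constraint and $H$ is $\bot$ or an unknown predicate. A translation of models keeps the interpretation of $\Sigma$ and defines the new unknown predicates by first-order formulas over $\Sigma$ and the old unknown predicates; it is efficient if these defining formulas are given by a uniform scheme of size polynomial in $|U|$ and the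 sizes of the variable vectors. -}

module Defs where

open import Level using (Level; _⊔_; suc)
open import Data.Nat using (ℕ; _+_; _≤_)
open import Data.Nat.Solver using (module +-*-Solver)
open import Data.Fin using (Fin)
open import Data.Empty using (⊥; ⊥-elim)
import Data.Unit.Polymorphic as Polymorphic
import Data.Empty.Polymorphic as Polymorphic
open import Data.Maybe using (Maybe; just; nothing; maybe′)
open import Data.Product using (Σ-syntax; _×_; _,_)
open import Data.Sum using (_⊎_)
open import Data.Vec using ([]; _∷_)
open import Data.List using (List; []; _∷_; _++_; foldr; map; length; tabulate)
open import Data.List.Membership.Propositional using (_∈_)
open import Data.List.Relation.Unary.All as All using (All; []; _∷_)
open import Data.List.Relation.Unary.All.Properties using () renaming (++⁺ to _⧺_)
open import Data.List.Relation.Binary.Subset.Propositional using (_⊆_)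
open import Data.List.Relation.Binary.Subset.Propositional.Properties
  using (∷⁺ʳ; xs⊆xs++ys; xs⊆ys++xs; ⊆-refl; ⊆-trans)
open import Relation.Binary.PropositionalEquality using (_≡_)
open import Relation.Unary using (Pred)

open +-*-Solver using (Polynomial; ⟦_⟧)

private variable
  σ t ℓ : Level

infix  8 _≐_
infixr 7 _∧_
infixr 6 _∨_
infixr 5 _⇒_

------------------------------------------------------------------------
-- Many-sorted first-order logic with equality

record Signature (σ : Level) : Set (suc σ) where
  field
    Sort  : Set σ
    Fun   : Set σ
    dom   : Fun → List Sort
    cod   : Fun → Sort
    Rel   : Set σ
    arity : Rel → List Sort

-- Finite vectors of sorted variables. Variables are positions, so the
-- blocks of a concatenation of contexts are disjoint by construction.
Ctx : Signature σ → Set σ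
Ctx S = List (Signature.Sort S)

record Unknowns (S : Signature σ) : Set (suc σ) where
  field
    Symbol : Set
    arity  : Symbol → Ctx S

open Unknowns public using (Symbol)

∅ : {S : Signature σ} → Unknowns S
∅ = record { Symbol = ⊥ ; arity = ⊥-elim }

data Term (S : Signature σ) (Γ : Ctx S) : Signature.Sort S → Set σ where
  var : ∀ {s} → s ∈ Γ → Term S Γ s
  fun : ∀ f → All (Term S Γ) (Signature.dom S f) → Term S Γ (Signature.cod S f)

-- Formulas over S extended by the unknown predicates P, with free
-- variables among Γ.
data Formula {S : Signature σ} (P : Unknowns S) (Γ : Ctx S) : Set σ where
  rel         : ∀ r → All (Term S Γ) (Signature.arity S r) → Formula P Γ
  unk         : ∀ p → All (Term S Γ) (Unknowns.arity P p) → Formula P Γ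
  _≐_         : ∀ {s} → Term S Γ s → Term S Γ s → Formula P Γ
  ⊤ᶠ ⊥ᶠ       : Formula P Γ
  _∧_ _∨_ _⇒_ : Formula P Γ → Formula P Γ → Formula P Γ
  ∀ᶠ ∃ᶠ       : ∀ {s} → Formula P (s ∷ Γ) → Formula P Γ

Constraint : (S : Signature σ) → Ctx S → Set σ
Constraint S Γ = Formula {S = S} ∅ Γ

Theory : Signature σ → (t : Level) → Set (σ ⊔ suc t)
Theory S t = Pred (Constraint S []) t

module _ {S : Signature σ} {P : Unknowns S} {Γ : Ctx S} where

  ⋀ ⋁ : List (Formula P Γ) → Formula P Γ
  ⋀ = foldr _∧_ ⊤ᶠ
  ⋁ = foldr _∨_ ⊥ᶠ

module _ {S : Signature σ} where

  mutual
    renameTerm : ∀ {Γ Δ s} → Γ ⊆ Δ → Term S Γ s → Term S Δ s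
    renameTerm θ (var x)    = var (θ x)
    renameTerm θ (fun f ts) = fun f (renameTerms θ ts)

    renameTerms : ∀ {Γ Δ ss} → Γ ⊆ Δ → All (Term S Γ) ss → All (Term S Δ) ss
    renameTerms θ []       = []
    renameTerms θ (t ∷ ts) = renameTerm θ t ∷ renameTerms θ ts

  rename : ∀ {P : Unknowns S} {Γ Δ} → Γ ⊆ Δ → Formula P Γ → Formula P Δ
  rename θ (rel r ts) = rel r (renameTerms θ ts)
  rename θ (unk p ts) = unk p (renameTerms θ ts)
  rename θ (t ≐ u)    = renameTerm θ t ≐ renameTerm θ u
  rename θ ⊤ᶠ         = ⊤ᶠ
  rename θ ⊥ᶠ         = ⊥ᶠ
  rename θ (φ ∧ ψ)    = rename θ φ ∧ rename θ ψ
  rename θ (φ ∨ ψ)    = rename θ φ ∨ rename θ ψ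
  rename θ (φ ⇒ ψ)    = rename θ φ ⇒ rename θ ψ
  rename θ (∀ᶠ {s} φ) = ∀ᶠ (rename (∷⁺ʳ s θ) φ)
  rename θ (∃ᶠ {s} φ) = ∃ᶠ (rename (∷⁺ʳ s θ) φ)

  lift : ∀ {P : Unknowns S} {Γ} → Constraint S Γ → Formula P Γ
  lift (rel r ts) = rel r ts
  lift (t ≐ u)    = t ≐ u
  lift ⊤ᶠ         = ⊤ᶠ
  lift ⊥ᶠ         = ⊥ᶠ
  lift (φ ∧ ψ)    = lift φ ∧ lift ψ
  lift (φ ∨ ψ)    = lift φ ∨ lift ψ
  lift (φ ⇒ ψ)    = lift φ ⇒ lift ψ
  lift (∀ᶠ φ)     = ∀ᶠ (lift φ)
  lift (∃ᶠ φ)     = ∃ᶠ (lift φ)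

  -- The number of symbol and variable occurrences.
  mutual
    sizeTerm : ∀ {Γ s} → Term S Γ s → ℕ
    sizeTerm (var x)    = 1
    sizeTerm (fun f ts) = 1 + sizeTerms ts

    sizeTerms : ∀ {Γ ss} → All (Term S Γ) ss → ℕ
    sizeTerms []       = 0
    sizeTerms (t ∷ ts) = sizeTerm t + sizeTerms ts

  size : ∀ {P : Unknowns S} {Γ} → Formula P Γ → ℕ
  size (rel r ts) = 1 + sizeTerms ts
  size (unk p ts) = 1 + sizeTerms ts
  size (t ≐ u)    = 1 + sizeTerm t + sizeTerm u
  size ⊤ᶠ         = 1
  size ⊥ᶠ         = 1
  size (φ ∧ ψ)    = 1 + size φ + size ψ
  size (φ ∨ ψ)    = 1 + size φ + size ψ
  size (φ ⇒ ψ)    = 1 + size φ + size ψ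
  size (∀ᶠ φ)     = 2 + size φ
  size (∃ᶠ φ)     = 2 + size φ

------------------------------------------------------------------------
-- Semantics

record Structure (S : Signature σ) (ℓ : Level) : Set (σ ⊔ suc ℓ) where
  open Signature S
  field
    Dom      : Sort → Set ℓ
    nonempty : ∀ s → Dom s
    ⟦fun⟧    : ∀ f → All Dom (dom f) → Dom (cod f)
    ⟦rel⟧    : ∀ r → All Dom (arity r) → Set ℓ

  Env : List Sort → Set (σ ⊔ ℓ)
  Env Γ = All Dom Γ

Interpretation : {S : Signature σ} → Structure S ℓ → Unknowns S → Set (σ ⊔ suc ℓ)
Interpretation {ℓ = ℓ} M P = ∀ p → Structure.Env M (Unknowns.arity P p) → Set ℓ

module _ {S : Signature σ} (M : Structure S ℓ) where
  open Structure M

  mutual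
    evalTerm : ∀ {Γ s} → Env Γ → Term S Γ s → Dom s
    evalTerm ρ (var x)    = All.lookup ρ x
    evalTerm ρ (fun f ts) = ⟦fun⟧ f (evalTerms ρ ts)

    evalTerms : ∀ {Γ ss} → Env Γ → All (Term S Γ) ss → Env ss
    evalTerms ρ []       = []
    evalTerms ρ (t ∷ ts) = evalTerm ρ t ∷ evalTerms ρ ts

  -- Tarskian satisfaction. It obeys classical logic only if the
  -- metatheory does, i.e. given ExcludedMiddle ℓ.
  Sat : ∀ {P Γ} → Interpretation M P → Env Γ → Formula P Γ → Set ℓ
  Sat I ρ (rel r ts) = ⟦rel⟧ r (evalTerms ρ ts)
  Sat I ρ (unk p ts) = I p (evalTerms ρ ts)
  Sat I ρ (t ≐ u)    = evalTerm ρ t ≡ evalTerm ρ u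
  Sat I ρ ⊤ᶠ         = Polymorphic.⊤
  Sat I ρ ⊥ᶠ         = Polymorphic.⊥
  Sat I ρ (φ ∧ ψ)    = Sat I ρ φ × Sat I ρ ψ
  Sat I ρ (φ ∨ ψ)    = Sat I ρ φ ⊎ Sat I ρ ψ
  Sat I ρ (φ ⇒ ψ)    = Sat I ρ φ → Sat I ρ ψ
  Sat I ρ (∀ᶠ {s} φ) = ∀ (d : Dom s) → Sat I (d ∷ ρ) φ
  Sat I ρ (∃ᶠ {s} φ) = Σ[ d ∈ Dom s ] Sat I (d ∷ ρ) φ

  -- Free variables are read as universally quantified.
  Valid : ∀ {P Γ} → Interpretation M P → Formula P Γ → Set (σ ⊔ ℓ)
  Valid I φ = ∀ ρ → Sat I ρ φ

FormulaSet : {S : Signature σ} → Unknowns S → Set (suc σ)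
FormulaSet {σ} P = ∀ {Γ} → Formula P Γ → Set σ

module _ {S : Signature σ} (T : Theory S t) {P : Unknowns S} (F : FormulaSet P) where

  IsModel : (M : Structure S ℓ) → Interpretation M P → Set (σ ⊔ t ⊔ ℓ)
  IsModel M I = (∀ φ → T φ → Valid M {∅} (λ ()) φ)
              × (∀ {Γ} (φ : Formula P Γ) → F φ → Valid M I φ)

  Satisfiable : (ℓ : Level) → Set (σ ⊔ t ⊔ suc ℓ)
  Satisfiable ℓ = Σ[ M ∈ Structure S ℓ ] Σ[ I ∈ Interpretation M P ] IsModel M I

------------------------------------------------------------------------
-- Constrained Horn clauses

module _ {S : Signature σ} (P : Unknowns S) where

  Atom : Ctx S → Set σ
  Atom Γ = Σ[ p ∈ Symbol P ] All (_∈ Γ) (Unknowns.arity P p)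

  infix 4 _&_⟶_

  record CHC (Γ : Ctx S) : Set σ where
    constructor _&_⟶_
    field
      body       : List (Atom Γ)
      constraint : Constraint S Γ
      head       : Maybe (Atom Γ)   -- nothing stands for ⊥

module _ {S : Signature σ} {P : Unknowns S} {Γ : Ctx S} where

  atom : Atom P Γ → Formula P Γ
  atom (p , xs) = unk p (All.map var xs)

  clause : CHC P Γ → Formula P Γ
  clause (as & φ ⟶ h) = ⋀ (map atom as) ∧ lift φ ⇒ maybe′ atom ⊥ᶠ h

------------------------------------------------------------------------
-- Translations of models

Definitions : {S : Signature σ} (P Q : Unknowns S) → Set σ
Definitions P Q = ∀ q → Formula P (Unknowns.arity Q q)

translate : {S : Signature σ} {P Q : Unknowns S} → Definitions P Q →
            (M : Structure S ℓ) → Interpretation M P → Interpretation M Q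
translate τ M I q ρ = Sat M I ρ (τ q)

UnknownsFamily : (σ : Level) → Set (suc σ)
UnknownsFamily σ = (S : Signature σ) → ℕ → (V W : Ctx S) → Unknowns S

-- Defining formulas given uniformly in |U|, V and W; in particular they
-- depend neither on the theory nor on the constraints α, β, γ, δ.
Scheme : {σ : Level} (P Q : UnknownsFamily σ) → Set (suc σ)
Scheme {σ} P Q = (S : Signature σ) (n : ℕ) (V W : Ctx S) →
                 Definitions (P S n V W) (Q S n V W)

-- A single polynomial in |U|, |V|, |W| bounds all the defining formulas.
-- (The solver's negation is the identity on ℕ, so Polynomial 3 denotes
-- exactly the polynomials with natural coefficients.)
PolynomialSize : (P Q : UnknownsFamily σ) → Scheme P Q → Set (suc σ)
PolynomialSize P Q τ = Σ[ p ∈ Polynomial 3 ] (∀ S n V W q →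
  size (τ S n V W q) ≤ ⟦ p ⟧ (n ∷ length V ∷ length W ∷ []))

------------------------------------------------------------------------
-- The two systems, with U = Fin n

data ASymbol (n : ℕ) : Set where
  inv : ASymbol n
  act : Fin n → ASymbol n

AUnknowns : UnknownsFamily σ
AUnknowns S n V W = record
  { Symbol = ASymbol n
  ; arity  = λ { inv → V ; (act u) → V ++ W }
  }

DUnknowns : UnknownsFamily σ
DUnknowns S n V W = record { Symbol = Fin n ; arity = λ u → V ++ W }

record Constraints (S : Signature σ) (n : ℕ) (V W : Ctx S) : Set σ where
  field
    α β : Constraint S V
    γ   : Fin n → Constraint S (V ++ W)
    δ   : Fin n → Constraint S (V ++ V ++ W)   -- over 𝒱, 𝒱′, 𝒲

module Vocabulary (S : Signature σ) (n : ℕ) (V W : Ctx S) where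

  𝒱⊆𝒱𝒲 : V ⊆ V ++ W
  𝒱⊆𝒱𝒲 = xs⊆xs++ys V W

  𝒲⊆𝒱𝒲 : W ⊆ V ++ W
  𝒲⊆𝒱𝒲 = xs⊆ys++xs W V

  𝒱⊆𝒱𝒱′𝒲 : V ⊆ V ++ V ++ W
  𝒱⊆𝒱𝒱′𝒲 = xs⊆xs++ys V (V ++ W)

  𝒱′⊆𝒱𝒱′𝒲 : V ⊆ V ++ V ++ W
  𝒱′⊆𝒱𝒱′𝒲 = ⊆-trans 𝒱⊆𝒱𝒲 (xs⊆ys++xs (V ++ W) V)

  𝒲⊆𝒱𝒱′𝒲 : W ⊆ V ++ V ++ W
  𝒲⊆𝒱𝒱′𝒲 = ⊆-trans 𝒲⊆𝒱𝒲 (xs⊆ys++xs (V ++ W) V)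

  𝒱𝒱′𝒲⊆𝒱𝒱′𝒲𝒲′ : V ++ V ++ W ⊆ (V ++ V ++ W) ++ W
  𝒱𝒱′𝒲⊆𝒱𝒱′𝒲𝒲′ = xs⊆xs++ys (V ++ V ++ W) W

  𝒱⊆𝒱𝒱′𝒲𝒲′ : V ⊆ (V ++ V ++ W) ++ W
  𝒱⊆𝒱𝒱′𝒲𝒲′ = ⊆-trans 𝒱⊆𝒱𝒱′𝒲 𝒱𝒱′𝒲⊆𝒱𝒱′𝒲𝒲′

  𝒱′⊆𝒱𝒱′𝒲𝒲′ : V ⊆ (V ++ V ++ W) ++ W
  𝒱′⊆𝒱𝒱′𝒲𝒲′ = ⊆-trans 𝒱′⊆𝒱𝒱′𝒲 𝒱𝒱′𝒲⊆𝒱𝒱′𝒲𝒲′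

  𝒲⊆𝒱𝒱′𝒲𝒲′ : W ⊆ (V ++ V ++ W) ++ W
  𝒲⊆𝒱𝒱′𝒲𝒲′ = ⊆-trans 𝒲⊆𝒱𝒱′𝒲 𝒱𝒱′𝒲⊆𝒱𝒱′𝒲𝒲′

  𝒲′⊆𝒱𝒱′𝒲𝒲′ : W ⊆ (V ++ V ++ W) ++ W
  𝒲′⊆𝒱𝒱′𝒲𝒲′ = xs⊆ys++xs W (V ++ V ++ W)

  -- The vector of variables which an inclusion of contexts picks out.
  block : ∀ {Γ Δ : Ctx S} → Γ ⊆ Δ → All (_∈ Δ) Γ
  block θ = All.tabulate θ

  Inv : ∀ {Γ} → V ⊆ Γ → Formula (AUnknowns S n V W) Γ
  Inv v = atom (inv , block v)

  Act : ∀ {Γ} → Fin n → V ⊆ Γ → W ⊆ Γ → Formula (AUnknowns S n V W) Γ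
  Act u v w = atom (act u , block v ⧺ block w)

  Dis : ∀ {Γ} → Fin n → V ⊆ Γ → W ⊆ Γ → Atom (DUnknowns S n V W) Γ
  Dis u v w = u , block v ⧺ block w

module _ {S : Signature σ} {n : ℕ} {V W : Ctx S} (Φ : Constraints S n V W) where
  open Constraints Φ
  open Vocabulary S n V W

  data A : FormulaSet (AUnknowns S n V W) where
    A1 :       A (lift α ⇒ Inv ⊆-refl)
    A2 :       A (Inv ⊆-refl ∧ lift β ⇒ ⊥ᶠ)
    A3 : ∀ u → A (Inv 𝒱⊆𝒱𝒲 ∧ Act u 𝒱⊆𝒱𝒲 𝒲⊆𝒱𝒲 ∧ lift (γ u) ⇒ ⊥ᶠ)
    A4 : ∀ u → A (Inv 𝒱⊆𝒱𝒱′𝒲 ∧ Act u 𝒱⊆𝒱𝒱′𝒲 𝒲⊆𝒱𝒱′𝒲 ∧ lift (δ u) ⇒ Inv 𝒱′⊆𝒱𝒱′𝒲)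
    A5 :       A (Inv 𝒱⊆𝒱𝒲 ⇒ ⋁ (tabulate λ u → Act u 𝒱⊆𝒱𝒲 𝒲⊆𝒱𝒲))

  data DClause : ∀ {Γ} → CHC (DUnknowns S n V W) Γ → Set σ where
    D1 :       DClause (tabulate (λ u → Dis u 𝒱⊆𝒱𝒲 𝒲⊆𝒱𝒲) & rename 𝒱⊆𝒱𝒲 α ⟶ nothing)
    D2 : ∀ u → DClause ([] & rename 𝒱⊆𝒱𝒲 β ⟶ just (Dis u 𝒱⊆𝒱𝒲 𝒲⊆𝒱𝒲))
    D3 : ∀ u → DClause ([] & γ u ⟶ just (Dis u 𝒱⊆𝒱𝒲 𝒲⊆𝒱𝒲))
    D4 : ∀ u → DClause (tabulate (λ u′ → Dis u′ 𝒱′⊆𝒱𝒱′𝒲𝒲′ 𝒲′⊆𝒱𝒱′𝒲𝒲′)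
                          & rename 𝒱𝒱′𝒲⊆𝒱𝒱′𝒲𝒲′ (δ u)
                          ⟶ just (Dis u 𝒱⊆𝒱𝒱′𝒲𝒲′ 𝒲⊆𝒱𝒱′𝒲𝒲′))

  data D : FormulaSet (DUnknowns S n V W) where
    chc : ∀ {Γ} {c : CHC (DUnknowns S n V W) Γ} → DClause c → D (clause c)

{-# OPTIONS --safe #-}
module Submission where

-- From (A) to (D) take D_u := ¬ (Inv ∧ A_u); from (D) to (A) take
-- A_u := ¬ D_u and Inv(𝒱) := ∀ 𝒲. ¬ ⋀_u D_u(𝒱, 𝒲). Excluded middle is
-- needed only for (A5), and nonempty domains only for (A2), where some
-- value of 𝒲 is required to refute Inv.

open import Level using (Level; _⊔_)
open import Data.Nat using (ℕ; _+_; _*_)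
open import Data.Nat.Properties
  using (+-commutativeSemigroup; +-assoc; ≤-reflexive; ≤-trans; m≤m+n; m≤n+m)
open import Data.Nat.Solver using (module +-*-Solver)
open import Algebra.Properties.CommutativeSemigroup +-commutativeSemigroup using (x∙yz≈y∙xz)
open import Data.Fin using (Fin; zero; suc)
open import Data.Fin.Properties using (¬∀⟶∃¬)
open import Data.Empty using (⊥)
import Data.Empty.Polymorphic as Polymorphic
import Data.Unit.Polymorphic as Polymorphic
open import Data.Product using (Σ-syntax; ∃; ∃₂; _×_; _,_)
open import Data.Product.Function.NonDependent.Propositional using (_×-⇔_)
open import Data.Sum using (inj₁; inj₂)
open import Data.Sum.Function.Propositional using (_⊎-⇔_)
open import Data.Vec using ([]; _∷_)
open import Data.List using ([]; _∷_; _++_; map; length; tabulate)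
open import Data.List.Properties using (length-++)
open import Data.List.Membership.Propositional using (_∈_)
open import Data.List.Relation.Unary.All as All using (All; []; _∷_)
import Data.List.Relation.Unary.All.Properties as All
open import Data.List.Relation.Unary.All.Properties using () renaming (++⁺ to infixr 5 _⧺_)
open import Data.List.Relation.Unary.Any using (Any; here; there)
import Data.List.Relation.Unary.Any.Properties as Any
open import Data.List.Relation.Binary.Subset.Propositional using (_⊆_)
open import Data.List.Relation.Binary.Subset.Propositional.Properties
  using (∷⁺ʳ; xs⊆xs++ys; xs⊆ys++xs; ⊆-refl)
open import Function using (_∘_)
open import Function.Bundles using (_⇔_; mk⇔; Equivalence)
open import Function.Construct.Composition using (_⇔-∘_)
open import Function.Construct.Identity using (⇔-id)
open import Function.Related.TypeIsomorphisms using (→-cong-⇔)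
open import Relation.Nullary using (¬_)
open import Relation.Binary.PropositionalEquality using (_≡_; refl; sym; trans; cong; cong₂)
open import Axiom.ExcludedMiddle using (ExcludedMiddle)
open import Defs

open Equivalence using (to; from)

private variable
  σ t ℓ a b : Level

-- Equivalences between types.

≡⇒⇔ : {X Y : Set a} → X ≡ Y → X ⇔ Y
≡⇒⇔ refl = ⇔-id _

Π-cong-⇔ : {X : Set a} {Y Z : X → Set b} → (∀ x → Y x ⇔ Z x) → (∀ x → Y x) ⇔ (∀ x → Z x)
Π-cong-⇔ e = mk⇔ (λ f x → to (e x) (f x)) (λ f x → from (e x) (f x))

Σ-cong-⇔ : {X : Set a} {Y Z : X → Set b} → (∀ x → Y x ⇔ Z x) → ∃ Y ⇔ ∃ Z
Σ-cong-⇔ e = mk⇔ (λ (x , y) → x , to (e x) y) (λ (x , z) → x , from (e x) z)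

-- Satisfaction of `⊥ᶠ` lands in the empty type at level `ℓ`, whereas `¬_` targets the one at level
-- zero; this bridges the two.
⊥-⇔ : Polymorphic.⊥ {ℓ} ⇔ ⊥
⊥-⇔ = mk⇔ (λ ()) (λ ())

-- Quantifier blocks and the sizes of formulas.

module _ {S : Signature σ} where

  private variable
    P : Unknowns S
    Γ Δ : Ctx S

  -- The head of a context is the most recently bound variable, so its quantifier must be innermost:
  -- it is attached to `φ` first, and the rest of the block is wrapped around the result.
  ∀* : ∀ Δ → Formula P (Δ ++ Γ) → Formula P Γ
  ∀* []      φ = φ
  ∀* (s ∷ Δ) φ = ∀* Δ (∀ᶠ φ)

  size-vars : (xs : All (_∈ Γ) Δ) → sizeTerms {S = S} (All.map var xs) ≡ length Δ
  size-vars []       = refl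
  size-vars (x ∷ xs) = cong (1 +_) (size-vars xs)

  -- Each quantifier costs 2, for the symbol and its variable. Since `∀*` puts the head quantifier
  -- inside, its 2 has to be moved past the cost of the tail.
  size-∀* : ∀ Δ (φ : Formula P (Δ ++ Γ)) → size (∀* Δ φ) ≡ length Δ * 2 + size φ
  size-∀* []      φ = refl
  size-∀* (s ∷ Δ) φ = trans (size-∀* Δ (∀ᶠ φ)) (x∙yz≈y∙xz (length Δ * 2) 2 (size φ))

  -- Every conjunct pays `k` for itself and 1 for its connective; the final 1 is the `⊤ᶠ` that ends
  -- the fold.
  size-⋀-atoms : ∀ {n k} (f : Fin n → Atom P Γ) → (∀ u → size (atom {S = S} (f u)) ≡ k) →
                 size (⋀ (map (atom {S = S}) (tabulate f))) ≡ n * (1 + k) + 1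
  size-⋀-atoms {n = ℕ.zero}      f h = refl
  size-⋀-atoms {n = ℕ.suc n} {k} f h =
    trans (cong₂ (λ i j → 1 + i + j) (h zero) (size-⋀-atoms (f ∘ suc) (h ∘ suc)))
          (sym (+-assoc (1 + k) (n * (1 + k)) 1))

-- Environments, renaming and evaluation.

module _ {S : Signature σ} (M : Structure S ℓ) where
  open Structure M

  private variable
    P : Unknowns S
    Γ Δ Θ : Ctx S

  someEnv : ∀ Γ → Env Γ
  someEnv Γ = All.universal nonempty Γ

  -- The decomposition comes with an equation so that matching on `refl` replaces an arbitrary
  -- environment by a concatenation of blocks, the form in which the formulas of both systems are
  -- analysed.
  splitEnv : ∀ Γ {Δ} (ρ : Env (Γ ++ Δ)) → ∃₂ λ (x : Env Γ) (y : Env Δ) → ρ ≡ x ⧺ y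
  splitEnv []      ρ = [] , ρ , refl
  splitEnv (s ∷ Γ) (d ∷ ρ) with x , y , refl ← splitEnv Γ ρ = d ∷ x , y , refl

  -- The semantic side of an inclusion: seen through `θ`, the environment `ρ` looks like `x`. The
  -- lookup form chains by `trans` along composite inclusions and extends under binders.
  Reads : Env Δ → Γ ⊆ Δ → Env Γ → Set (σ ⊔ ℓ)
  Reads {Γ = Γ} ρ θ x = ∀ {s} (i : s ∈ Γ) → All.lookup ρ (θ i) ≡ All.lookup x i

  reads-left : (x : Env Γ) (y : Env Δ) → Reads (x ⧺ y) (xs⊆xs++ys Γ Δ) x
  reads-left (d ∷ x) y (here refl) = refl
  reads-left (d ∷ x) y (there i)   = reads-left x y i

  reads-right : (x : Env Γ) (y : Env Δ) → Reads (x ⧺ y) (xs⊆ys++xs Δ Γ) y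
  reads-right []      y i = refl
  reads-right (d ∷ x) y i = reads-right x y i

  reads-∷⁺ʳ : ∀ {s} (d : Dom s) {ρ : Env Δ} {θ : Γ ⊆ Δ} {x : Env Γ} →
              Reads ρ θ x → Reads (d ∷ ρ) (∷⁺ʳ s θ) (d ∷ x)
  reads-∷⁺ʳ d r (here refl) = refl
  reads-∷⁺ʳ d r (there i)   = r i

  -- Lets an atom on a block of variables be read as the predicate at the values of that block. The
  -- inclusion is arbitrary because the tail is read through `θ ∘ there`.
  evalTerms-block : (ρ : Env Δ) (θ : Γ ⊆ Δ) (x : Env Γ) → Reads ρ θ x →
                    evalTerms M ρ (All.map var (All.tabulate θ)) ≡ x
  evalTerms-block ρ θ []      r = refl
  evalTerms-block ρ θ (d ∷ x) r =
    cong₂ _∷_ (r (here refl)) (evalTerms-block ρ (θ ∘ there) x (r ∘ there))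

  evalTerms-⧺ : (ρ : Env Θ) (xs : All (_∈ Θ) Γ) (ys : All (_∈ Θ) Δ) →
                evalTerms M ρ (All.map var (xs ⧺ ys)) ≡
                evalTerms M ρ (All.map var xs) ⧺ evalTerms M ρ (All.map var ys)
  evalTerms-⧺ ρ []       ys = refl
  evalTerms-⧺ ρ (x ∷ xs) ys = cong (_ ∷_) (evalTerms-⧺ ρ xs ys)

  evalTerms-blocks : (ρ : Env Θ) (v : Γ ⊆ Θ) (w : Δ ⊆ Θ) (x : Env Γ) (y : Env Δ) →
                     Reads ρ v x → Reads ρ w y →
                     evalTerms M ρ (All.map var (All.tabulate v ⧺ All.tabulate w)) ≡ x ⧺ y
  evalTerms-blocks ρ v w x y rv rw =
    trans (evalTerms-⧺ ρ (All.tabulate v) (All.tabulate w))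
          (cong₂ _⧺_ (evalTerms-block ρ v x rv) (evalTerms-block ρ w y rw))

  module _ (ρ : Env Δ) (θ : Γ ⊆ Δ) (x : Env Γ) (r : Reads ρ θ x) where

    mutual
      evalTerm-rename : ∀ {s} (u : Term S Γ s) → evalTerm M ρ (renameTerm θ u) ≡ evalTerm M x u
      evalTerm-rename (var i)    = r i
      evalTerm-rename (fun f us) = cong (⟦fun⟧ f) (evalTerms-rename us)

      evalTerms-rename : ∀ {ss} (us : All (Term S Γ) ss) →
                         evalTerms M ρ (renameTerms θ us) ≡ evalTerms M x us
      evalTerms-rename []       = refl
      evalTerms-rename (u ∷ us) = cong₂ _∷_ (evalTerm-rename u) (evalTerms-rename us)

  -- An equivalence rather than an equality of types: the quantifier and implication cases then go
  -- through without function extensionality.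
  Sat-rename : (I : Interpretation M P) (ρ : Env Δ) (θ : Γ ⊆ Δ) (x : Env Γ) → Reads ρ θ x →
               (φ : Formula P Γ) → Sat M I ρ (rename θ φ) ⇔ Sat M I x φ
  Sat-rename I ρ θ x r (rel p us) = ≡⇒⇔ (cong (⟦rel⟧ p) (evalTerms-rename ρ θ x r us))
  Sat-rename I ρ θ x r (unk p us) = ≡⇒⇔ (cong (I p) (evalTerms-rename ρ θ x r us))
  Sat-rename I ρ θ x r (u ≐ u′)   =
    ≡⇒⇔ (cong₂ _≡_ (evalTerm-rename ρ θ x r u) (evalTerm-rename ρ θ x r u′))
  Sat-rename I ρ θ x r ⊤ᶠ         = ⇔-id _
  Sat-rename I ρ θ x r ⊥ᶠ         = ⇔-id _
  Sat-rename I ρ θ x r (φ ∧ ψ)    = Sat-rename I ρ θ x r φ ×-⇔ Sat-rename I ρ θ x r ψ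
  Sat-rename I ρ θ x r (φ ∨ ψ)    = Sat-rename I ρ θ x r φ ⊎-⇔ Sat-rename I ρ θ x r ψ
  Sat-rename I ρ θ x r (φ ⇒ ψ)    =
    →-cong-⇔ (Sat-rename I ρ θ x r φ) (Sat-rename I ρ θ x r ψ)
  Sat-rename I ρ θ x r (∀ᶠ {s} φ) = Π-cong-⇔ λ d →
    Sat-rename I (d ∷ ρ) (∷⁺ʳ s θ) (d ∷ x) (reads-∷⁺ʳ d {ρ} {θ} {x} r) φ
  Sat-rename I ρ θ x r (∃ᶠ {s} φ) = Σ-cong-⇔ λ d →
    Sat-rename I (d ∷ ρ) (∷⁺ʳ s θ) (d ∷ x) (reads-∷⁺ʳ d {ρ} {θ} {x} r) φ

  -- Constraints do not see the unknown predicates.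

  Holds : Env Γ → Constraint S Γ → Set ℓ
  Holds = Sat M λ ()

  -- A constraint contains no `unk`, so its truth is fixed by `M` alone. This is what lets (A) and
  -- (D) share the truth values of their constraints although their unknowns differ.
  Sat-lift : (I : Interpretation M P) (ρ : Env Γ) (φ : Constraint S Γ) →
             Sat M I ρ (lift φ) ⇔ Holds ρ φ
  Sat-lift I ρ (rel p us) = ⇔-id _
  Sat-lift I ρ (u ≐ u′)   = ⇔-id _
  Sat-lift I ρ ⊤ᶠ         = ⇔-id _
  Sat-lift I ρ ⊥ᶠ         = ⇔-id _
  Sat-lift I ρ (φ ∧ ψ)    = Sat-lift I ρ φ ×-⇔ Sat-lift I ρ ψ
  Sat-lift I ρ (φ ∨ ψ)    = Sat-lift I ρ φ ⊎-⇔ Sat-lift I ρ ψ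
  Sat-lift I ρ (φ ⇒ ψ)    = →-cong-⇔ (Sat-lift I ρ φ) (Sat-lift I ρ ψ)
  Sat-lift I ρ (∀ᶠ φ)     = Π-cong-⇔ λ d → Sat-lift I (d ∷ ρ) φ
  Sat-lift I ρ (∃ᶠ φ)     = Σ-cong-⇔ λ d → Sat-lift I (d ∷ ρ) φ

  Sat-lift-rename : (I : Interpretation M P) (ρ : Env Δ) (θ : Γ ⊆ Δ) (x : Env Γ) → Reads ρ θ x →
                    (φ : Constraint S Γ) → Sat M I ρ (lift (rename θ φ)) ⇔ Holds x φ
  Sat-lift-rename I ρ θ x r φ = Sat-rename (λ ()) ρ θ x r φ ⇔-∘ Sat-lift I ρ (rename θ φ)

  -- Finite connectives and quantifier blocks.

  module _ (I : Interpretation M P) (ρ : Env Γ) where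

    Sat-⋀ : ∀ φs → Sat M I ρ (⋀ φs) ⇔ All (Sat M I ρ) φs
    Sat-⋀ []       = mk⇔ (λ _ → []) _
    Sat-⋀ (φ ∷ φs) = mk⇔ (λ (h , hs) → h ∷ to (Sat-⋀ φs) hs)
                         (λ { (h ∷ hs) → h , from (Sat-⋀ φs) hs })

    Sat-⋁ : ∀ φs → Sat M I ρ (⋁ φs) ⇔ Any (Sat M I ρ) φs
    Sat-⋁ []       = mk⇔ (λ ()) (λ ())
    Sat-⋁ (φ ∷ φs) = mk⇔ (λ { (inj₁ h) → here h ; (inj₂ hs) → there (to (Sat-⋁ φs) hs) })
                         (λ { (here h) → inj₁ h ; (there hs) → inj₂ (from (Sat-⋁ φs) hs) })

    Sat-⋀-atoms : ∀ {n} (f : Fin n → Atom P Γ) →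
                  Sat M I ρ (⋀ (map atom (tabulate f))) ⇔ (∀ u → Sat M I ρ (atom (f u)))
    Sat-⋀-atoms f = mk⇔ (All.tabulate⁻ ∘ All.map⁻) (All.map⁺ ∘ All.tabulate⁺) ⇔-∘ Sat-⋀ _

    Sat-⋁-tabulate : ∀ {n} (f : Fin n → Formula P Γ) →
                     Sat M I ρ (⋁ (tabulate f)) ⇔ ∃ λ u → Sat M I ρ (f u)
    Sat-⋁-tabulate f = mk⇔ Any.tabulate⁻ (λ (u , h) → Any.tabulate⁺ u h) ⇔-∘ Sat-⋁ _

  Sat-∀* : (I : Interpretation M P) (ρ : Env Γ) → ∀ Δ (φ : Formula P (Δ ++ Γ)) →
           Sat M I ρ (∀* Δ φ) ⇔ (∀ (x : Env Δ) → Sat M I (x ⧺ ρ) φ)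
  Sat-∀* I ρ []      φ = mk⇔ (λ { h [] → h }) (λ h → h [])
  -- The induction hypothesis for `∀ᶠ φ` takes the tail `x` before the head `d`; the arguments are
  -- swapped to form `d ∷ x`.
  Sat-∀* I ρ (s ∷ Δ) φ = mk⇔ (λ { h (d ∷ x) → h x d }) (λ h x d → h (d ∷ x)) ⇔-∘ Sat-∀* I ρ Δ (∀ᶠ φ)

-- Truth of the atoms of both systems.

module _ {S : Signature σ} {n : ℕ} {V W : Ctx S} (M : Structure S ℓ) where
  open Structure M
  open Vocabulary S n V W

  module _ (I : Interpretation M (AUnknowns S n V W)) {Γ : Ctx S} (ρ : Env Γ) where

    Sat-Inv : (v : V ⊆ Γ) (x : Env V) → Reads M ρ v x → Sat M I ρ (Inv v) ⇔ I inv x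
    Sat-Inv v x r = ≡⇒⇔ (cong (I inv) (evalTerms-block M ρ v x r))

    Sat-Act : ∀ u (v : V ⊆ Γ) (w : W ⊆ Γ) (x : Env V) (y : Env W) →
              Reads M ρ v x → Reads M ρ w y → Sat M I ρ (Act u v w) ⇔ I (act u) (x ⧺ y)
    Sat-Act u v w x y rv rw = ≡⇒⇔ (cong (I (act u)) (evalTerms-blocks M ρ v w x y rv rw))

  module _ (J : Interpretation M (DUnknowns S n V W)) {Γ : Ctx S} (ρ : Env Γ) where

    Sat-Dis : ∀ u (v : V ⊆ Γ) (w : W ⊆ Γ) (x : Env V) (y : Env W) →
              Reads M ρ v x → Reads M ρ w y → Sat M J ρ (atom (Dis u v w)) ⇔ J u (x ⧺ y)
    Sat-Dis u v w x y rv rw = ≡⇒⇔ (cong (J u) (evalTerms-blocks M ρ v w x y rv rw))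

    Sat-⋀-Dis : (v : V ⊆ Γ) (w : W ⊆ Γ) (x : Env V) (y : Env W) →
                Reads M ρ v x → Reads M ρ w y →
                Sat M J ρ (⋀ (map atom (tabulate λ u → Dis u v w))) ⇔ (∀ u → J u (x ⧺ y))
    Sat-⋀-Dis v w x y rv rw =
      Π-cong-⇔ (λ u → Sat-Dis u v w x y rv rw) ⇔-∘ Sat-⋀-atoms M J ρ (λ u → Dis u v w)

-- Models of (A) and (D) in terms of environments.

module _ {S : Signature σ} {n : ℕ} {V W : Ctx S} (Φ : Constraints S n V W) (M : Structure S ℓ) where
  open Structure M
  open Constraints Φ
  open Vocabulary S n V W

  -- Together with `DModel`, a syntax-free reading of the system, one environment per variable
  -- block, so that the two translations can be verified without contexts and renamings.
  record AModel (I : Interpretation M (AUnknowns S n V W)) : Set (σ ⊔ ℓ) where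
    field
      a1 : ∀ x → Holds M x α → I inv x
      a2 : ∀ x → I inv x → ¬ Holds M x β
      a3 : ∀ u (x : Env V) (y : Env W) → I inv x → I (act u) (x ⧺ y) → ¬ Holds M (x ⧺ y) (γ u)
      a4 : ∀ u (x x′ : Env V) (y : Env W) →
           I inv x → I (act u) (x ⧺ y) → Holds M (x ⧺ x′ ⧺ y) (δ u) → I inv x′
      a5 : ∀ (x : Env V) (y : Env W) → I inv x → ∃ λ u → I (act u) (x ⧺ y)

  record DModel (J : Interpretation M (DUnknowns S n V W)) : Set (σ ⊔ ℓ) where
    field
      d1 : ∀ (x : Env V) (y : Env W) → (∀ u → J u (x ⧺ y)) → ¬ Holds M x α
      d2 : ∀ u (x : Env V) (y : Env W) → Holds M x β → J u (x ⧺ y)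
      d3 : ∀ u (x : Env V) (y : Env W) → Holds M (x ⧺ y) (γ u) → J u (x ⧺ y)
      d4 : ∀ u (x x′ : Env V) (y y′ : Env W) → (∀ u′ → J u′ (x′ ⧺ y′)) →
           Holds M (x ⧺ x′ ⧺ y) (δ u) → J u (x ⧺ y)

  module _ {I : Interpretation M (AUnknowns S n V W)} {J : Interpretation M (DUnknowns S n V W)} where

    -- By (A5), at an `Inv` state and any value of 𝒲 some `A_u` holds, so that `D_u` fails; thus all
    -- `D_u` together refute `Inv`. Applied to the state produced by (A1) or (A4), this gives (D1)
    -- and (D4), while (D2) and (D3) restate (A2) and (A3). Knowing `J` only up to equivalence keeps
    -- defining formulas out of the argument.
    AModel⇒DModel : (∀ u (x : Env V) (y : Env W) → J u (x ⧺ y) ⇔ (¬ (I inv x × I (act u) (x ⧺ y)))) →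
                    AModel I → DModel J
    AModel⇒DModel J⇔ m = record
      { d1 = λ x y h hα → let i = a1 x hα ; u , k = a5 x y i in to (J⇔ u x y) (h u) (i , k)
      ; d2 = λ u x y hβ → from (J⇔ u x y) λ (i , _) → a2 x i hβ
      ; d3 = λ u x y hγ → from (J⇔ u x y) λ (i , k) → a3 u x y i k hγ
      ; d4 = λ u x x′ y y′ h hδ → from (J⇔ u x y) λ (i , k) →
          let i′ = a4 u x x′ y i k hδ ; u′ , k′ = a5 x′ y′ i′ in to (J⇔ u′ x′ y′) (h u′) (i′ , k′)
      }
      where open AModel m

    -- (A1) and (A4) contrapose (D1) and (D4): if all `D_u` held at the state claimed to be in
    -- `Inv`, then `α` would fail, respectively `D_u` would hold at the source, against `A_u`.
    DModel⇒AModel : ExcludedMiddle ℓ →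
                    (∀ x → I inv x ⇔ (∀ (y : Env W) → ¬ (∀ u → J u (x ⧺ y)))) →
                    (∀ u (x : Env V) (y : Env W) → I (act u) (x ⧺ y) ⇔ (¬ J u (x ⧺ y))) →
                    DModel J → AModel I
    DModel⇒AModel em inv⇔ act⇔ m = record
      { a1 = λ x hα → from (inv⇔ x) λ y h → d1 x y h hα
      -- By (D2), `β` makes every `D_u` true whatever 𝒲 is, but `Inv` can be contradicted only at a
      -- concrete value of 𝒲.
      ; a2 = λ x i hβ → to (inv⇔ x) i (someEnv M W) λ u → d2 u x (someEnv M W) hβ
      ; a3 = λ u x y _ k hγ → to (act⇔ u x y) k (d3 u x y hγ)
      ; a4 = λ u x x′ y _ k hδ → from (inv⇔ x′) λ y′ h → to (act⇔ u x y) k (d4 u x x′ y y′ h hδ)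
      -- `U` is finite and `em` decides each `D_u`, so a failing conjunction yields a failing index.
      -- For empty `U` the conjunction is vacuously true, and `Inv` is empty.
      ; a5 = λ x y i → let u , k = ¬∀⟶∃¬ n (λ u → J u (x ⧺ y)) (λ _ → em) (to (inv⇔ x) i y)
                       in u , from (act⇔ u x y) k
      }
      where open DModel m

  -- The formulas of (A) against the conditions of `AModel`.

  module _ (I : Interpretation M (AUnknowns S n V W)) where

    private
      A1⇔ : ∀ x → Sat M I x (lift α ⇒ Inv ⊆-refl) ⇔ (Holds M x α → I inv x)
      A1⇔ x = →-cong-⇔ (Sat-lift M I x α) (Sat-Inv M I x ⊆-refl x (λ _ → refl))

      A2⇔ : ∀ x → Sat M I x (Inv ⊆-refl ∧ lift β ⇒ ⊥ᶠ) ⇔ (I inv x × Holds M x β → ⊥)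
      A2⇔ x = →-cong-⇔ (Sat-Inv M I x ⊆-refl x (λ _ → refl) ×-⇔ Sat-lift M I x β) ⊥-⇔

      Inv⇔ : ∀ (x : Env V) (y : Env W) → Sat M I (x ⧺ y) (Inv 𝒱⊆𝒱𝒲) ⇔ I inv x
      Inv⇔ x y = Sat-Inv M I (x ⧺ y) 𝒱⊆𝒱𝒲 x (reads-left M x y)

      Act⇔ : ∀ u (x : Env V) (y : Env W) → Sat M I (x ⧺ y) (Act u 𝒱⊆𝒱𝒲 𝒲⊆𝒱𝒲) ⇔ I (act u) (x ⧺ y)
      Act⇔ u x y = Sat-Act M I (x ⧺ y) u 𝒱⊆𝒱𝒲 𝒲⊆𝒱𝒲 x y (reads-left M x y) (reads-right M x y)

      A3⇔ : ∀ u (x : Env V) (y : Env W) →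
            Sat M I (x ⧺ y) (Inv 𝒱⊆𝒱𝒲 ∧ Act u 𝒱⊆𝒱𝒲 𝒲⊆𝒱𝒲 ∧ lift (γ u) ⇒ ⊥ᶠ) ⇔
            (I inv x × I (act u) (x ⧺ y) × Holds M (x ⧺ y) (γ u) → ⊥)
      A3⇔ u x y = →-cong-⇔ (Inv⇔ x y ×-⇔ (Act⇔ u x y ×-⇔ Sat-lift M I (x ⧺ y) (γ u))) ⊥-⇔

      A4⇔ : ∀ u (x x′ : Env V) (y : Env W) →
            Sat M I (x ⧺ x′ ⧺ y)
              (Inv 𝒱⊆𝒱𝒱′𝒲 ∧ Act u 𝒱⊆𝒱𝒱′𝒲 𝒲⊆𝒱𝒱′𝒲 ∧ lift (δ u) ⇒ Inv 𝒱′⊆𝒱𝒱′𝒲) ⇔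
            (I inv x × I (act u) (x ⧺ y) × Holds M (x ⧺ x′ ⧺ y) (δ u) → I inv x′)
      A4⇔ u x x′ y =
        →-cong-⇔ (Sat-Inv M I ρ 𝒱⊆𝒱𝒱′𝒲 x r
                   ×-⇔ (Sat-Act M I ρ u 𝒱⊆𝒱𝒱′𝒲 𝒲⊆𝒱𝒱′𝒲 x y r ry ×-⇔ Sat-lift M I ρ (δ u)))
                 (Sat-Inv M I ρ 𝒱′⊆𝒱𝒱′𝒲 x′ r′)
        where
        ρ : Env (V ++ V ++ W)
        ρ = x ⧺ x′ ⧺ y
        r : Reads M ρ 𝒱⊆𝒱𝒱′𝒲 x
        r = reads-left M x (x′ ⧺ y)
        -- The primed block is reached by skipping 𝒱 and then taking the left part of what remains.
        r′ : Reads M ρ 𝒱′⊆𝒱𝒱′𝒲 x′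
        r′ i = trans (reads-right M x (x′ ⧺ y) _) (reads-left M x′ y i)
        ry : Reads M ρ 𝒲⊆𝒱𝒱′𝒲 y
        ry i = trans (reads-right M x (x′ ⧺ y) _) (reads-right M x′ y i)

      A5⇔ : ∀ (x : Env V) (y : Env W) →
            Sat M I (x ⧺ y) (Inv 𝒱⊆𝒱𝒲 ⇒ ⋁ (tabulate λ u → Act u 𝒱⊆𝒱𝒲 𝒲⊆𝒱𝒲)) ⇔
            (I inv x → ∃ λ u → I (act u) (x ⧺ y))
      A5⇔ x y = →-cong-⇔ (Inv⇔ x y)
        (Σ-cong-⇔ (λ u → Act⇔ u x y) ⇔-∘ Sat-⋁-tabulate M I (x ⧺ y) (λ u → Act u 𝒱⊆𝒱𝒲 𝒲⊆𝒱𝒲))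

    Valid⇒AModel : (∀ {Γ} (φ : Formula (AUnknowns S n V W) Γ) → A Φ φ → Valid M I φ) → AModel I
    Valid⇒AModel valid = record
      { a1 = λ x → to (A1⇔ x) (valid _ A1 x)
      ; a2 = λ x i h → to (A2⇔ x) (valid _ A2 x) (i , h)
      ; a3 = λ u x y i k h → to (A3⇔ u x y) (valid _ (A3 u) (x ⧺ y)) (i , k , h)
      ; a4 = λ u x x′ y i k h → to (A4⇔ u x x′ y) (valid _ (A4 u) (x ⧺ x′ ⧺ y)) (i , k , h)
      ; a5 = λ x y → to (A5⇔ x y) (valid _ A5 (x ⧺ y))
      }

    AModel⇒Valid : AModel I → ∀ {Γ} (φ : Formula (AUnknowns S n V W) Γ) → A Φ φ → Valid M I φ
    AModel⇒Valid m _ A1 x = from (A1⇔ x) (AModel.a1 m x)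
    AModel⇒Valid m _ A2 x = from (A2⇔ x) λ (i , h) → AModel.a2 m x i h
    AModel⇒Valid m _ (A3 u) ρ with x , y , refl ← splitEnv M V ρ =
      from (A3⇔ u x y) λ (i , k , h) → AModel.a3 m u x y i k h
    AModel⇒Valid m _ (A4 u) ρ
      with x , ρ′ , refl ← splitEnv M V ρ
      with x′ , y , refl ← splitEnv M V ρ′ =
      from (A4⇔ u x x′ y) λ (i , k , h) → AModel.a4 m u x x′ y i k h
    AModel⇒Valid m _ A5 ρ with x , y , refl ← splitEnv M V ρ =
      from (A5⇔ x y) (AModel.a5 m x y)

  -- The clauses of (D) against the conditions of `DModel`.

  module _ (J : Interpretation M (DUnknowns S n V W)) where

    private
      Dis⇔ : ∀ u (x : Env V) (y : Env W) → Sat M J (x ⧺ y) (atom (Dis u 𝒱⊆𝒱𝒲 𝒲⊆𝒱𝒲)) ⇔ J u (x ⧺ y)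
      Dis⇔ u x y = Sat-Dis M J (x ⧺ y) u 𝒱⊆𝒱𝒲 𝒲⊆𝒱𝒲 x y (reads-left M x y) (reads-right M x y)

      D1⇔ : ∀ (x : Env V) (y : Env W) →
            Sat M J (x ⧺ y)
              (⋀ (map atom (tabulate λ u → Dis u 𝒱⊆𝒱𝒲 𝒲⊆𝒱𝒲)) ∧ lift (rename 𝒱⊆𝒱𝒲 α) ⇒ ⊥ᶠ) ⇔
            ((∀ u → J u (x ⧺ y)) × Holds M x α → ⊥)
      D1⇔ x y = →-cong-⇔
        (Sat-⋀-Dis M J (x ⧺ y) 𝒱⊆𝒱𝒲 𝒲⊆𝒱𝒲 x y (reads-left M x y) (reads-right M x y)
          ×-⇔ Sat-lift-rename M J (x ⧺ y) 𝒱⊆𝒱𝒲 x (reads-left M x y) α)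
        ⊥-⇔

      -- A clause with empty body still contains the empty conjunction `⊤ᶠ`, hence the trivial
      -- factor in the premise.
      D2⇔ : ∀ u (x : Env V) (y : Env W) →
            Sat M J (x ⧺ y) (⊤ᶠ ∧ lift (rename 𝒱⊆𝒱𝒲 β) ⇒ atom (Dis u 𝒱⊆𝒱𝒲 𝒲⊆𝒱𝒲)) ⇔
            (Polymorphic.⊤ {ℓ} × Holds M x β → J u (x ⧺ y))
      D2⇔ u x y = →-cong-⇔
        (⇔-id _ ×-⇔ Sat-lift-rename M J (x ⧺ y) 𝒱⊆𝒱𝒲 x (reads-left M x y) β) (Dis⇔ u x y)

      D3⇔ : ∀ u (x : Env V) (y : Env W) →
            Sat M J (x ⧺ y) (⊤ᶠ ∧ lift (γ u) ⇒ atom (Dis u 𝒱⊆𝒱𝒲 𝒲⊆𝒱𝒲)) ⇔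
            (Polymorphic.⊤ {ℓ} × Holds M (x ⧺ y) (γ u) → J u (x ⧺ y))
      D3⇔ u x y = →-cong-⇔ (⇔-id _ ×-⇔ Sat-lift M J (x ⧺ y) (γ u)) (Dis⇔ u x y)

      D4⇔ : ∀ u (x x′ : Env V) (y y′ : Env W) →
            Sat M J ((x ⧺ x′ ⧺ y) ⧺ y′)
              (⋀ (map atom (tabulate λ u′ → Dis u′ 𝒱′⊆𝒱𝒱′𝒲𝒲′ 𝒲′⊆𝒱𝒱′𝒲𝒲′))
                ∧ lift (rename 𝒱𝒱′𝒲⊆𝒱𝒱′𝒲𝒲′ (δ u)) ⇒ atom (Dis u 𝒱⊆𝒱𝒱′𝒲𝒲′ 𝒲⊆𝒱𝒱′𝒲𝒲′)) ⇔
            ((∀ u′ → J u′ (x′ ⧺ y′)) × Holds M (x ⧺ x′ ⧺ y) (δ u) → J u (x ⧺ y))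
      D4⇔ u x x′ y y′ = →-cong-⇔
        (Sat-⋀-Dis M J ρ 𝒱′⊆𝒱𝒱′𝒲𝒲′ 𝒲′⊆𝒱𝒱′𝒲𝒲′ x′ y′ r′ (reads-right M (x ⧺ x′ ⧺ y) y′)
          ×-⇔ Sat-lift-rename M J ρ 𝒱𝒱′𝒲⊆𝒱𝒱′𝒲𝒲′ (x ⧺ x′ ⧺ y) (reads-left M (x ⧺ x′ ⧺ y) y′) (δ u))
        (Sat-Dis M J ρ u 𝒱⊆𝒱𝒱′𝒲𝒲′ 𝒲⊆𝒱𝒱′𝒲𝒲′ x y r ry)
        where
        ρ : Env ((V ++ V ++ W) ++ W)
        ρ = (x ⧺ x′ ⧺ y) ⧺ y′
        r : Reads M ρ 𝒱⊆𝒱𝒱′𝒲𝒲′ x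
        r i = trans (reads-left M (x ⧺ x′ ⧺ y) y′ _) (reads-left M x (x′ ⧺ y) i)
        r′ : Reads M ρ 𝒱′⊆𝒱𝒱′𝒲𝒲′ x′
        r′ i = trans (reads-left M (x ⧺ x′ ⧺ y) y′ _)
                 (trans (reads-right M x (x′ ⧺ y) _) (reads-left M x′ y i))
        ry : Reads M ρ 𝒲⊆𝒱𝒱′𝒲𝒲′ y
        ry i = trans (reads-left M (x ⧺ x′ ⧺ y) y′ _)
                 (trans (reads-right M x (x′ ⧺ y) _) (reads-right M x′ y i))

    Valid⇒DModel : (∀ {Γ} (φ : Formula (DUnknowns S n V W) Γ) → D Φ φ → Valid M J φ) → DModel J
    Valid⇒DModel valid = record
      { d1 = λ x y h hα → to (D1⇔ x y) (valid _ (chc D1) (x ⧺ y)) (h , hα)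
      ; d2 = λ u x y h → to (D2⇔ u x y) (valid _ (chc (D2 u)) (x ⧺ y)) (_ , h)
      ; d3 = λ u x y h → to (D3⇔ u x y) (valid _ (chc (D3 u)) (x ⧺ y)) (_ , h)
      ; d4 = λ u x x′ y y′ h hδ →
          to (D4⇔ u x x′ y y′) (valid _ (chc (D4 u)) ((x ⧺ x′ ⧺ y) ⧺ y′)) (h , hδ)
      }

    DModel⇒Valid : DModel J → ∀ {Γ} (φ : Formula (DUnknowns S n V W) Γ) → D Φ φ → Valid M J φ
    DModel⇒Valid m _ (chc D1) ρ with x , y , refl ← splitEnv M V ρ =
      from (D1⇔ x y) λ (h , hα) → DModel.d1 m x y h hα
    DModel⇒Valid m _ (chc (D2 u)) ρ with x , y , refl ← splitEnv M V ρ =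
      from (D2⇔ u x y) λ (_ , h) → DModel.d2 m u x y h
    DModel⇒Valid m _ (chc (D3 u)) ρ with x , y , refl ← splitEnv M V ρ =
      from (D3⇔ u x y) λ (_ , h) → DModel.d3 m u x y h
    DModel⇒Valid m _ (chc (D4 u)) ρ
      -- The context is bracketed as (𝒱𝒱′𝒲)𝒲′, so 𝒲′ is split off first.
      with ρ′ , y′ , refl ← splitEnv M (V ++ V ++ W) ρ
      with x , ρ″ , refl ← splitEnv M V ρ′
      with x′ , y , refl ← splitEnv M V ρ″ =
      from (D4⇔ u x x′ y y′) λ (h , hδ) → DModel.d4 m u x x′ y y′ h hδ

-- The translations and their correctness.

A→D : Scheme {σ} AUnknowns DUnknowns
A→D S n V W u = Inv 𝒱⊆𝒱𝒲 ∧ Act u 𝒱⊆𝒱𝒲 𝒲⊆𝒱𝒲 ⇒ ⊥ᶠ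
  where open Vocabulary S n V W

-- Quantified variables enter at the front, so below `∀* W` the context is `W ++ V`, and the two
-- inclusions change sides.
D→A : Scheme {σ} DUnknowns AUnknowns
D→A S n V W inv     = ∀* W (⋀ (map atom (tabulate λ u → Dis u (xs⊆ys++xs V W) (xs⊆xs++ys W V))) ⇒ ⊥ᶠ)
  where open Vocabulary S n V W
D→A S n V W (act u) = atom (Dis u 𝒱⊆𝒱𝒲 𝒲⊆𝒱𝒲) ⇒ ⊥ᶠ
  where open Vocabulary S n V W

module _ {S : Signature σ} (T : Theory S t) {n : ℕ} {V W : Ctx S} (Φ : Constraints S n V W)
         (M : Structure S ℓ) where
  open Structure M
  open Vocabulary S n V W

  A→D-isModel : (I : Interpretation M (AUnknowns S n V W)) →
                IsModel T (A Φ) M I → IsModel T (D Φ) M (translate (A→D S n V W) M I)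
  A→D-isModel I (thy , valid) =
    -- The structure is unchanged, so it still satisfies the theory.
    thy , DModel⇒Valid Φ M J (AModel⇒DModel Φ M J⇔ (Valid⇒AModel Φ M I valid))
    where
    J = translate (A→D S n V W) M I
    J⇔ : ∀ u (x : Env V) (y : Env W) → J u (x ⧺ y) ⇔ (¬ (I inv x × I (act u) (x ⧺ y)))
    J⇔ u x y = →-cong-⇔
      (Sat-Inv M I (x ⧺ y) 𝒱⊆𝒱𝒲 x (reads-left M x y)
        ×-⇔ Sat-Act M I (x ⧺ y) u 𝒱⊆𝒱𝒲 𝒲⊆𝒱𝒲 x y (reads-left M x y) (reads-right M x y))
      ⊥-⇔

  D→A-isModel : ExcludedMiddle ℓ → (J : Interpretation M (DUnknowns S n V W)) →
                IsModel T (D Φ) M J → IsModel T (A Φ) M (translate (D→A S n V W) M J)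
  D→A-isModel em J (thy , valid) =
    thy , AModel⇒Valid Φ M I (DModel⇒AModel Φ M em inv⇔ act⇔ (Valid⇒DModel Φ M J valid))
    where
    I = translate (D→A S n V W) M J
    inv⇔ : ∀ x → I inv x ⇔ (∀ (y : Env W) → ¬ (∀ u → J u (x ⧺ y)))
    inv⇔ x = Π-cong-⇔ (λ y → →-cong-⇔
        (Sat-⋀-Dis M J (y ⧺ x) (xs⊆ys++xs V W) (xs⊆xs++ys W V) x y
          (reads-right M y x) (reads-left M y x))
        ⊥-⇔)
      ⇔-∘ Sat-∀* M J x W _
    act⇔ : ∀ u (x : Env V) (y : Env W) → I (act u) (x ⧺ y) ⇔ (¬ J u (x ⧺ y))
    act⇔ u x y = →-cong-⇔
      (Sat-Dis M J (x ⧺ y) u 𝒱⊆𝒱𝒲 𝒲⊆𝒱𝒲 x y (reads-left M x y) (reads-right M x y)) ⊥-⇔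

-- Polynomial size bounds.

module _ {S : Signature σ} {n : ℕ} {V W : Ctx S} {Γ : Ctx S} (v : V ⊆ Γ) (w : W ⊆ Γ) where
  open Vocabulary S n V W

  size-Inv : size (Inv v) ≡ 1 + length V
  size-Inv = cong (1 +_) (size-vars (block v))

  size-Act : ∀ u → size (Act u v w) ≡ 1 + (length V + length W)
  size-Act u = cong (1 +_) (trans (size-vars (block v ⧺ block w)) (length-++ V))

  size-Dis : ∀ u → size (atom {S = S} (Dis u v w)) ≡ 1 + (length V + length W)
  size-Dis u = cong (1 +_) (trans (size-vars (block v ⧺ block w)) (length-++ V))

module _ where
  open +-*-Solver renaming (var to X)

  private
    ∣U∣ ∣V∣ ∣W∣ : Polynomial 3
    ∣U∣ = X zero
    ∣V∣ = X (suc zero)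
    ∣W∣ = X (suc (suc zero))

  -- The polynomial copies the shape of the size computation, so once the atom sizes are substituted
  -- both sides agree by evaluation.
  A→D-polynomial : PolynomialSize {σ} AUnknowns DUnknowns A→D
  A→D-polynomial =
    con 1 :+ (con 1 :+ (con 1 :+ ∣V∣) :+ (con 1 :+ (∣V∣ :+ ∣W∣))) :+ con 1 ,
    λ S n V W u → let open Vocabulary S n V W in
      ≤-reflexive (cong₂ (λ i j → 1 + (1 + i + j) + 1)
        (size-Inv {S = S} {n = n} 𝒱⊆𝒱𝒲 𝒲⊆𝒱𝒲) (size-Act {S = S} {n = n} 𝒱⊆𝒱𝒲 𝒲⊆𝒱𝒲 u))

  -- One polynomial must serve both kinds of symbol: `p` is the exact size for `inv`, `q` for
  -- `act u`, and over ℕ their sum bounds each.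
  D→A-polynomial : PolynomialSize {σ} DUnknowns AUnknowns D→A
  D→A-polynomial = p :+ q , λ
    { S n V W inv → ≤-trans
        (≤-reflexive (trans (size-∀* W _)
          (cong (λ i → length W * 2 + (1 + i + 1))
            (size-⋀-atoms _ (size-Dis {S = S} {n = n} (xs⊆ys++xs V W) (xs⊆xs++ys W V))))))
        (m≤m+n (⟦ p ⟧ (n ∷ length V ∷ length W ∷ [])) _)
    ; S n V W (act u) → let open Vocabulary S n V W in ≤-trans
        (≤-reflexive (cong (λ i → 1 + i + 1) (size-Dis {S = S} {n = n} 𝒱⊆𝒱𝒲 𝒲⊆𝒱𝒲 u)))
        (m≤n+m (⟦ q ⟧ (n ∷ length V ∷ length W ∷ [])) (⟦ p ⟧ (n ∷ length V ∷ length W ∷ [])))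
    }
    where
    p q : Polynomial 3
    -- The quantifier prefix contributes `∣W∣ :* con 2`; the rest is the negated conjunction of
    -- `∣U∣` atoms, ending in `⊤ᶠ`.
    p = ∣W∣ :* con 2 :+ (con 1 :+ (∣U∣ :* (con 1 :+ (con 1 :+ (∣V∣ :+ ∣W∣))) :+ con 1) :+ con 1)
    q = con 1 :+ (con 1 :+ (∣V∣ :+ ∣W∣)) :+ con 1

theorem4p2 : ∀ {σ t ℓ : Level} →
    (ExcludedMiddle ℓ →
    ∀ (S : Signature σ) (T : Theory S t) (n : ℕ) (V W : Ctx S) (Φ : Constraints S n V W) →
    Satisfiable T (A Φ) ℓ ⇔ Satisfiable T (D Φ) ℓ)
    × (Σ[ τ ∈ Scheme {σ} AUnknowns DUnknowns ]
    PolynomialSize AUnknowns DUnknowns τ ×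
    (ExcludedMiddle ℓ →
    ∀ (S : Signature σ) (T : Theory S t) (n : ℕ) (V W : Ctx S) (Φ : Constraints S n V W) →
    ∀ (M : Structure S ℓ) (I : Interpretation M (AUnknowns S n V W)) →
    IsModel T (A Φ) M I → IsModel T (D Φ) M (translate (τ S n V W) M I)))
    × (Σ[ τ ∈ Scheme {σ} DUnknowns AUnknowns ]
    PolynomialSize DUnknowns AUnknowns τ ×
    (ExcludedMiddle ℓ →
    ∀ (S : Signature σ) (T : Theory S t) (n : ℕ) (V W : Ctx S) (Φ : Constraints S n V W) →
    ∀ (M : Structure S ℓ) (I : Interpretation M (DUnknowns S n V W)) →
    IsModel T (D Φ) M I → IsModel T (A Φ) M (translate (τ S n V W) M I)))
theorem4p2 =
    (λ em S T n V W Φ → mk⇔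
      (λ (M , I , m) → M , translate (A→D S n V W) M I , A→D-isModel T Φ M I m)
      (λ (M , J , m) → M , translate (D→A S n V W) M J , D→A-isModel T Φ M em J m))
  , (A→D , A→D-polynomial , λ _ S T n V W Φ M I → A→D-isModel T Φ M I)
  , (D→A , D→A-polynomial , λ em S T n V W Φ M J → D→A-isModel T Φ M em J)
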